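{- Let $n$ be a positive integer and let $H = (V, A, B)$ be an $n$-uniform cross-intersecting family with $\min(|A|, |B|) \geq 3$. Then $\chi(H) \leq 3$.
   Context: A hypergraph is a pair $(V,E)$ where $V$ is a set of vertices and $E$ is a set of subsets of $V$ (edges); it is $n$-uniform if every edge has exactly $n$ vertices. A cross-intersecting family $H = (V, A, B)$ is a hypergraph with vertex set $V$ and edge set $A \cup B$, where $A$ and $B$ are non-empty (not necessarily disjoint) sets of edges such that $a \cap b \neq \emptyset$ for every $a \in A$ and $b \in B$. A coloring of the vertices is proper if no edge of $A \cup B$ is monochromatic; the chromatic number $\chi(H)$ is the minimal number of colors in a proper coloring. -}

module Defs where

open import Data.Fin.Base using (Fin)
open import Data.Nat.Base using (ℕ; _≤_)
open import Data.Product.Base using (Σ-syntax; ∃-syntax; _×_)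
open import Data.Sum.Base using ([_,_]; inj₁; inj₂)
open import Function.Base using (_∘_)
open import Function.Definitions using (Injective)
open import Level using (Level; suc; _⊔_)
open import Relation.Binary.Definitions using (_Respects_)
open import Relation.Binary.PropositionalEquality.Core using (_≡_)
open import Relation.Nullary.Negation.Core using (¬_)
open import Relation.Unary using (Pred; _∈_; _∪_; _≐_; _≬_; Satisfiable)

private
  variable
    ℓ a : Level

-- Vertex sets may be infinite.  Subsets of V are predicates, compared by
-- extensional equality _≐_; a set of subsets must therefore respect _≐_.

record Hypergraph (ℓ a : Level) : Set (suc (ℓ ⊔ a)) where
  field
    V      : Set ℓ
    E      : Pred (Pred V ℓ) a
    E-resp : E Respects _≐_

-- The subset e has exactly n elements: it is the image of an injection
-- from Fin n.

HasSize : {V : Set ℓ} → ℕ → Pred V ℓ → Set ℓ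
HasSize {V = V} n e =
  Σ[ f ∈ (Fin n → V) ] Injective _≡_ _≡_ f × e ≐ (λ x → ∃[ i ] f i ≡ x)

-- The possibly infinite set F of subsets has at least k members, which are
-- pairwise distinct as subsets.

AtLeast : {V : Set ℓ} → ℕ → Pred (Pred V ℓ) a → Set (suc ℓ ⊔ a)
AtLeast {ℓ = ℓ} {V = V} k F =
  Σ[ f ∈ (Fin k → Pred V ℓ) ] Injective _≡_ _≐_ f × (∀ i → f i ∈ F)

module _ (H : Hypergraph ℓ a) where
  open Hypergraph H

  Uniform : ℕ → Set (suc ℓ ⊔ a)
  Uniform n = ∀ {e} → e ∈ E → HasSize n e

  Monochromatic : ∀ {k} → (V → Fin k) → Pred V ℓ → Set ℓ
  Monochromatic c e = ∀ {x y} → x ∈ e → y ∈ e → c x ≡ c y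

  Proper : ∀ {k} → (V → Fin k) → Set (suc ℓ ⊔ a)
  Proper c = ∀ {e} → e ∈ E → ¬ Monochromatic c e

  Colorable : ℕ → Set (suc ℓ ⊔ a)
  Colorable k = Σ[ c ∈ (V → Fin k) ] Proper c

  IsChromaticNumber : ℕ → Set (suc ℓ ⊔ a)
  IsChromaticNumber k = Colorable k × (∀ {m} → Colorable m → k ≤ m)

  -- The inequality χ(H) ≤ m, including that χ(H) exists.

  χ≤ : ℕ → Set (suc ℓ ⊔ a)
  χ≤ m = ∃[ k ] IsChromaticNumber k × k ≤ m

record CrossIntersectingFamily (ℓ a : Level) : Set (suc (ℓ ⊔ a)) where
  field
    V          : Set ℓ
    A B        : Pred (Pred V ℓ) a
    A-resp     : A Respects _≐_
    B-resp     : B Respects _≐_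
    A-nonempty : Satisfiable A
    B-nonempty : Satisfiable B
    cross      : ∀ {e f} → e ∈ A → f ∈ B → e ≬ f

  hypergraph : Hypergraph ℓ a
  hypergraph = record
    { V      = V
    ; E      = A ∪ B
    ; E-resp = λ eq → [ inj₁ ∘ A-resp eq , inj₂ ∘ B-resp eq ]
    }

{-# OPTIONS --safe #-}
-- Let a ∈ A and b ∈ B. Every edge meets a ∪ b, so three colors suffice as
-- soon as a ∪ b is covered by two sets that contain no edge. If a and b share
-- two vertices p and q, the sets a ∖ {q} and b ∖ {p} will do: they are smaller
-- than an edge. If p is the only common vertex and z another vertex of b, then
-- (a ∖ {p}) ∪ {z} and b ∖ {z} will do, unless (a ∖ {p}) ∪ {z} is an edge.
-- Hence, if H is not 3-colorable, a member of A and a member of B always share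
-- exactly one vertex, and all these exchanges produce edges. For n ≥ 3 the two
-- edges (a ∖ {p}) ∪ {z} and (b ∖ {p}) ∪ {x} then give a contradiction. For
-- n = 2 the exchange yields a triangle {p,x}, {x,z}, {p,z}, which forces one
-- of A and B to have at most two members.
module Submission where

open import Defs
open import Axiom.ExcludedMiddle using (ExcludedMiddle)
open import Data.Empty using (⊥)
open import Data.Fin.Base using (Fin; zero; suc; punchIn; punchOut)
open import Data.Fin.Properties
  using (injective⇒≤; punchIn-injective; punchInᵢ≢i; punchIn-punchOut)
open import Data.Nat.Base using (ℕ; zero; suc; _≤_; _<_; NonZero)
open import Data.Nat.Induction using (<-rec)
open import Data.Nat.Properties
  using (≤-refl; ≤-trans; <⇒≤; <⇒≱; ≮⇒≥)
open import Data.Product.Base using (∃-syntax; _×_; _,_; proj₁; proj₂)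
open import Data.Sum.Base as Sum using (inj₁; inj₂)
open import Function.Base using (_∘_)
open import Function.Definitions using (Injective)
open import Level using (Level; _⊔_) renaming (suc to lsuc)
open import Relation.Binary.PropositionalEquality
  using (_≡_; _≢_; refl; sym; trans; cong; subst)
open import Relation.Nullary.Decidable.Core using (Dec; yes; no; decidable-stable)
open import Relation.Nullary.Negation.Core using (¬_; contradiction)
open import Relation.Unary
  using (Pred; _∈_; _∉_; _⊆_; _∪_; _∖_; ∁; ｛_｝; _≐_; _≬_)
open import Relation.Unary.Properties using (≐-sym; ≐-trans; ≬-sym)

private
  variable
    ℓ a : Level
    m n : ℕ

-- Cardinalities of finite subsets.

module _ {V : Set ℓ} where

  private
    variable
      c d e : Pred V ℓ
      p : V

  HasSize-mono : HasSize m d → HasSize n e → d ⊆ e → m ≤ n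
  HasSize-mono {m = m} {n = n} (f , f-inj , _ , f∈) (g , _ , g⁻¹ , _) d⊆e =
    injective⇒≤ h-inj
    where
    preimage : ∀ i → ∃[ j ] g j ≡ f i
    preimage i = g⁻¹ (d⊆e (f∈ (i , refl)))

    h : Fin m → Fin n
    h i = proj₁ (preimage i)

    h-inj : Injective _≡_ _≡_ h
    h-inj {i} {j} eq = f-inj
      (trans (sym (proj₂ (preimage i))) (trans (cong g eq) (proj₂ (preimage j))))

  HasSize-｛｝ : HasSize 1 ｛ p ｝
  HasSize-｛｝ {p = p} =
    (λ _ → p) , (λ { {zero} {zero} _ → refl }) , (zero ,_) , proj₂

  HasSize-∖ : HasSize (suc n) e → p ∈ e → HasSize n (e ∖ ｛ p ｝)
  HasSize-∖ {e = e} {p = p} (f , f-inj , f⁻¹ , f∈) p∈e with f⁻¹ p∈e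
  ... | k , refl =
    -- `punchIn k` runs through all indices but that of `p`.
    f ∘ punchIn k , (λ eq → punchIn-injective k _ _ (f-inj eq)) , to , from
    where
    to : ∀ {x} → x ∈ e ∖ ｛ f k ｝ → ∃[ i ] f (punchIn k i) ≡ x
    to (x∈e , fk≢x) with f⁻¹ x∈e
    ... | j , refl = punchOut k≢j , cong f (punchIn-punchOut k≢j)
      where
      k≢j : k ≢ j
      k≢j = fk≢x ∘ cong f

    from : ∀ {x} → ∃[ i ] f (punchIn k i) ≡ x → x ∈ e ∖ ｛ f k ｝
    from (i , refl) = f∈ (_ , refl) , λ eq → punchInᵢ≢i k i (sym (f-inj eq))

  HasSize-∪ : HasSize n e → p ∉ e → HasSize (suc n) (e ∪ ｛ p ｝)
  HasSize-∪ {n = n} {e = e} {p = p} (f , f-inj , f⁻¹ , f∈) p∉e = g , g-inj , to , from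
    where
    g : Fin (suc n) → V
    g zero    = p
    g (suc i) = f i

    p≢f : ∀ i → p ≢ f i
    p≢f i refl = p∉e (f∈ (i , refl))

    g-inj : Injective _≡_ _≡_ g
    g-inj {zero}  {zero}  _  = refl
    g-inj {zero}  {suc j} eq = contradiction eq (p≢f j)
    g-inj {suc i} {zero}  eq = contradiction (sym eq) (p≢f i)
    g-inj {suc i} {suc j} eq = cong suc (f-inj eq)

    to : ∀ {x} → x ∈ e ∪ ｛ p ｝ → ∃[ i ] g i ≡ x
    to (inj₁ x∈e) with f⁻¹ x∈e
    ... | i , eq = suc i , eq
    to (inj₂ eq) = zero , eq

    from : ∀ {x} → ∃[ i ] g i ≡ x → x ∈ e ∪ ｛ p ｝
    from (zero  , eq) = inj₂ eq
    from (suc i , eq) = inj₁ (f∈ (i , eq))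

  ≬-∪-comm : e ≬ (d ∪ c) → e ≬ (c ∪ d)
  ≬-∪-comm (x , x∈e , x∈d∪c) = x , x∈e , Sum.swap x∈d∪c

  HasSize⇒∃ : HasSize (suc n) e → ∃[ x ] x ∈ e
  HasSize⇒∃ (f , _ , _ , f∈) = f zero , f∈ (zero , refl)

-- Equality of finite sets, and triangles of two-element edges.

module Classical (em : ∀ {p} → ExcludedMiddle p) where

  -- A vertex of `e` outside `d` could be deleted from `e`, leaving a set that contains `d` but is
  -- smaller than `d`.
  ⊆∧HasSize⇒≐ : {V : Set ℓ} {d e : Pred V ℓ} →
                HasSize n d → HasSize n e → d ⊆ e → d ≐ e
  ⊆∧HasSize⇒≐ {n = zero} _ (_ , _ , f⁻¹ , _) d⊆e =
    d⊆e , λ x∈e → contradiction (proj₁ (f⁻¹ x∈e)) λ ()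
  ⊆∧HasSize⇒≐ {n = suc n} |d| |e| d⊆e = d⊆e , λ {x} x∈e →
    decidable-stable em λ x∉d →
      <⇒≱ ≤-refl (HasSize-mono |d| (HasSize-∖ |e| x∈e)
        λ y∈d → d⊆e y∈d , λ { refl → x∉d y∈d })

  HasSize2⇒pair : {V : Set ℓ} {e : Pred V ℓ} {p q : V} →
                  HasSize 2 e → p ≢ q → p ∈ e → q ∈ e → ｛ p ｝ ∪ ｛ q ｝ ≐ e
  HasSize2⇒pair |e| p≢q p∈e q∈e = ⊆∧HasSize⇒≐ (HasSize-∪ HasSize-｛｝ p≢q) |e|
    λ { (inj₁ refl) → p∈e ; (inj₂ refl) → q∈e }

  HasSize2-unique : {V : Set ℓ} {d e : Pred V ℓ} {p q : V} →
                    HasSize 2 d → HasSize 2 e → p ≢ q →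
                    p ∈ d → q ∈ d → p ∈ e → q ∈ e → d ≐ e
  HasSize2-unique |d| |e| p≢q p∈d q∈d p∈e q∈e =
    ≐-trans (≐-sym (HasSize2⇒pair |d| p≢q p∈d q∈d)) (HasSize2⇒pair |e| p≢q p∈e q∈e)

  -- At most one of three pairwise distinct sets equals `e`, so testing the first two tells which
  -- pair to keep.
  AtLeast3⇒two-others : {V : Set ℓ} {F : Pred (Pred V ℓ) a} →
    AtLeast 3 F → (e : Pred V ℓ) →
    ∃[ c ] ∃[ d ] c ∈ F × d ∈ F × ¬ c ≐ d × ¬ c ≐ e × ¬ d ≐ e
  AtLeast3⇒two-others (f , f-inj , f∈F) e = choose em em
    where
    distinct : ∀ {i j} → i ≢ j → ¬ f i ≐ f j
    distinct i≢j = i≢j ∘ f-inj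

    other : ∀ {i j} → i ≢ j → f i ≐ e → ¬ f j ≐ e
    other i≢j fᵢ≐e fⱼ≐e = distinct i≢j (≐-trans fᵢ≐e (≐-sym fⱼ≐e))

    choose : Dec (f zero ≐ e) → Dec (f (suc zero) ≐ e) → _
    choose (yes f₀≐e) _ =
      _ , _ , f∈F (suc zero) , f∈F (suc (suc zero)) ,
      distinct (λ ()) , other (λ ()) f₀≐e , other (λ ()) f₀≐e
    choose (no f₀≭e) (yes f₁≐e) =
      _ , _ , f∈F zero , f∈F (suc (suc zero)) ,
      distinct (λ ()) , f₀≭e , other (λ ()) f₁≐e
    choose (no f₀≭e) (no f₁≭e) =
      _ , _ , f∈F zero , f∈F (suc zero) , distinct (λ ()) , f₀≭e , f₁≭e

  AtLeast3⇒another : {V : Set ℓ} {F : Pred (Pred V ℓ) a} →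
    AtLeast 3 F → (d e : Pred V ℓ) → ∃[ c ] c ∈ F × ¬ c ≐ d × ¬ c ≐ e
  AtLeast3⇒another F≥3 d e with AtLeast3⇒two-others F≥3 e
  ... | b , c , b∈F , c∈F , b≭c , b≭e , c≭e with em {P = b ≐ d}
  ...   | no  b≭d = b , b∈F , b≭d , b≭e
  ...   | yes b≐d = c , c∈F , (λ c≐d → b≭c (≐-trans b≐d (≐-sym c≐d))) , c≭e

  -- Here e, e′ and f are the sides {p,x}, {x,z} and {p,z} of a triangle. A
  -- member of B other than f has to contain x, while a member of A other than
  -- e and e′ cannot contain x.
  triangle⇒⊥ : {V : Set ℓ} {A B : Pred (Pred V ℓ) a} →
    (∀ {e} → e ∈ A → HasSize 2 e) → (∀ {e} → e ∈ B → HasSize 2 e) →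
    (∀ {e f} → e ∈ A → f ∈ B → e ≬ f) →
    (∀ {e f p q} → e ∈ A → f ∈ B → p ∈ e → p ∈ f → q ∈ e → q ∈ f → p ≡ q) →
    AtLeast 3 A → AtLeast 3 B →
    ∀ {e e′ f p x z} → e ∈ A → e′ ∈ A → f ∈ B →
    p ≢ x → x ≢ z → p ≢ z →
    p ∈ e → x ∈ e → x ∈ e′ → z ∈ e′ → p ∈ f → z ∈ f → ⊥
  triangle⇒⊥ {A = A} {B} |A| |B| cross meet A≥3 B≥3 {e} {e′} {f} {p} {x} {z}
    e∈A e′∈A f∈B p≢x x≢z p≢z p∈e x∈e x∈e′ z∈e′ p∈f z∈f
    with AtLeast3⇒two-others B≥3 f | AtLeast3⇒another A≥3 e e′
  ... | g , h , g∈B , h∈B , g≭h , g≭f , h≭f | c , c∈A , c≭e , c≭e′ = x∉c x∈c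
    where
    f⊆pz : f ⊆ ｛ p ｝ ∪ ｛ z ｝
    f⊆pz = proj₂ (HasSize2⇒pair (|B| f∈B) p≢z p∈f z∈f)

    -- If `k` met `e` and `e′` only outside `x`, it would contain `p` and `z` and hence equal `f`.
    x∈other : ∀ {k} → k ∈ B → ¬ k ≐ f → x ∈ k
    x∈other k∈B k≭f with cross e∈A k∈B | cross e′∈A k∈B
    ... | u , u∈e , u∈k | v , v∈e′ , v∈k
      with proj₂ (HasSize2⇒pair (|A| e∈A) p≢x p∈e x∈e) u∈e
         | proj₂ (HasSize2⇒pair (|A| e′∈A) x≢z x∈e′ z∈e′) v∈e′
    ... | inj₂ refl | _         = u∈k
    ... | inj₁ refl | inj₁ refl = v∈k
    ... | inj₁ refl | inj₂ refl =
      contradiction (HasSize2-unique (|B| k∈B) (|B| f∈B) p≢z u∈k v∈k p∈f z∈f) k≭f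

    -- A common vertex is `p` or `z`; together with `x` it gives `k` two vertices in common with `e`
    -- or with `e′`.
    disjoint-f : ∀ {k w} → k ∈ B → x ∈ k → w ∈ k → w ∉ f
    disjoint-f k∈B x∈k w∈k w∈f with f⊆pz w∈f
    ... | inj₁ refl = p≢x (meet e∈A k∈B p∈e w∈k x∈e x∈k)
    ... | inj₂ refl = x≢z (meet e′∈A k∈B x∈e′ x∈k z∈e′ w∈k)

    -- `c` meets `f` in `p` or `z`; with `x` as its other vertex it would be `e` or `e′`.
    x∉c : x ∉ c
    x∉c x∈c with cross c∈A f∈B
    ... | w , w∈c , w∈f with f⊆pz w∈f
    ... | inj₁ refl = c≭e (HasSize2-unique (|A| c∈A) (|A| e∈A) p≢x w∈c x∈c p∈e x∈e)
    ... | inj₂ refl = c≭e′ (HasSize2-unique (|A| c∈A) (|A| e′∈A) x≢z x∈c w∈c x∈e′ z∈e′)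

    x∈g : x ∈ g
    x∈g = x∈other g∈B g≭f

    x∈h : x ∈ h
    x∈h = x∈other h∈B h≭f

    -- Otherwise c consists of one further vertex of g and one of h, so it
    -- misses f.
    x∈c : x ∈ c
    x∈c = decidable-stable em λ x∉c →
      missing x∉c (cross c∈A g∈B) (cross c∈A h∈B) (cross c∈A f∈B)
      where
      missing : x ∉ c → c ≬ g → c ≬ h → c ≬ f → ⊥
      missing x∉c (s , s∈c , s∈g) (t , t∈c , t∈h) (w , w∈c , w∈f)
        with proj₂ (HasSize2⇒pair (|A| c∈A) s≢t s∈c t∈c) w∈c
        where
        s≢t : s ≢ t
        s≢t refl = g≭h (HasSize2-unique (|B| g∈B) (|B| h∈B)
          (λ { refl → x∉c s∈c }) x∈g s∈g x∈h t∈h)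
      ... | inj₁ refl = disjoint-f g∈B x∈g s∈g w∈f
      ... | inj₂ refl = disjoint-f h∈B x∈h t∈h w∈f

  -- Colorings from independent sets, and the exchange of vertices.

  module _ (H : Hypergraph ℓ a) where
    open Hypergraph H

    Independent : Pred V ℓ → Set (lsuc ℓ ⊔ a)
    Independent C = ∀ {e} → e ∈ E → ¬ e ⊆ C

    Transversal : Pred V ℓ → Set (lsuc ℓ ⊔ a)
    Transversal T = ∀ {e} → e ∈ E → e ≬ T

    -- Well-founded descent: as long as fewer colors suffice, pass to such a smaller number.
    Colorable⇒χ≤ : ∀ k → Colorable H k → χ≤ H k
    Colorable⇒χ≤ = <-rec _ λ k rec col → step k rec col em
      where
      step : ∀ k → (∀ {j} → j < k → Colorable H j → χ≤ H j) → Colorable H k →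
             Dec (∃[ j ] j < k × Colorable H j) → χ≤ H k
      step k rec col (no none) =
        k , (col , λ col′ → ≮⇒≥ λ j<k → none (_ , j<k , col′)) , ≤-refl
      step k rec col (yes (j , j<k , col′)) with rec j<k col′
      ... | i , χ≡i , i≤j = i , χ≡i , ≤-trans i≤j (<⇒≤ j<k)

    -- The third color class is the complement of `T`, which contains no edge because every edge
    -- meets `T`.
    cover⇒Colorable : ∀ {T C D} → Transversal T → T ⊆ C ∪ D →
                      Independent C → Independent D → Colorable H 3
    cover⇒Colorable {T} {C} {D} trans-T T⊆C∪D ind-C ind-D =
      proj₁ ∘ cover , proper
      where
      class : Fin 3 → Pred V ℓ
      class zero             = C
      class (suc zero)       = D
      class (suc (suc zero)) = ∁ T

      cover : ∀ x → ∃[ i ] x ∈ class i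
      cover x with em {P = x ∈ T}
      ... | no  x∉T = suc (suc zero) , x∉T
      ... | yes x∈T with T⊆C∪D x∈T
      ...   | inj₁ x∈C = zero , x∈C
      ...   | inj₂ x∈D = suc zero , x∈D

      independent : ∀ i → Independent (class i)
      independent zero             = ind-C
      independent (suc zero)       = ind-D
      independent (suc (suc zero)) e∈E e⊆∁T with trans-T e∈E
      ... | x , x∈e , x∈T = e⊆∁T x∈e x∈T

      proper : Proper H (proj₁ ∘ cover)
      -- The vertex `x` of the edge names the common color, whose class would then contain the whole
      -- edge.
      proper e∈E mono with trans-T e∈E
      ... | x , x∈e , _ = independent (proj₁ (cover x)) e∈E λ {y} y∈e →
        subst (λ i → y ∈ class i) (mono y∈e x∈e) (proj₂ (cover y))

    small⇒Independent : ∀ {C} → Uniform H n → HasSize m C → m < n → Independent C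
    small⇒Independent unif |C| m<n e∈E e⊆C =
      <⇒≱ m<n (HasSize-mono (unif e∈E) |C| e⊆C)

    nonedge⇒Independent : ∀ {C} → Uniform H n → HasSize n C → C ∉ E → Independent C
    nonedge⇒Independent unif |C| C∉E e∈E e⊆C =
      C∉E (E-resp (⊆∧HasSize⇒≐ (unif e∈E) |C| e⊆C) e∈E)

    module _ (unif : Uniform H (suc n)) {d e : Pred V ℓ} (d∈E : d ∈ E) (e∈E : e ∈ E)
             (trans-d∪e : Transversal (d ∪ e)) where

      -- Nothing is lost from the union: `q` survives in `e ∖ ｛ p ｝` and `p` in `d ∖ ｛ q ｝`.
      two-common⇒Colorable : ∀ {p q} → p ≢ q → p ∈ d → p ∈ e → q ∈ d → q ∈ e →
                             Colorable H 3
      two-common⇒Colorable {p} {q} p≢q p∈d p∈e q∈d q∈e =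
        cover⇒Colorable trans-d∪e (λ x∈d∪e → cover x∈d∪e em em)
          (small⇒Independent unif (HasSize-∖ (unif d∈E) q∈d) ≤-refl)
          (small⇒Independent unif (HasSize-∖ (unif e∈E) p∈e) ≤-refl)
        where
        cover : ∀ {x} → x ∈ d ∪ e → Dec (q ≡ x) → Dec (p ≡ x) →
                x ∈ (d ∖ ｛ q ｝) ∪ (e ∖ ｛ p ｝)
        cover (inj₁ x∈d) (no q≢x)   _          = inj₁ (x∈d , q≢x)
        cover (inj₁ x∈d) (yes refl) _          = inj₂ (q∈e , p≢q)
        cover (inj₂ x∈e) _          (no p≢x)   = inj₂ (x∈e , p≢x)
        cover (inj₂ x∈e) _          (yes refl) = inj₁ (p∈d , p≢q ∘ sym)

      -- The covering sets are the exchanged set and `e ∖ ｛ z ｝`. The latter is too small to contain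
      -- an edge, and the former, having full size, can contain only itself.
      exchange : ¬ Colorable H 3 → ∀ {p z} → p ∈ d → p ∈ e → z ∈ e → z ∉ d →
                 (d ∖ ｛ p ｝) ∪ ｛ z ｝ ∈ E
      exchange ¬col {p} {z} p∈d p∈e z∈e z∉d = decidable-stable em λ C∉E →
        ¬col (cover⇒Colorable trans-d∪e (λ x∈d∪e → cover x∈d∪e em em)
          (nonedge⇒Independent unif
            (HasSize-∪ (HasSize-∖ (unif d∈E) p∈d) (z∉d ∘ proj₁)) C∉E)
          (small⇒Independent unif (HasSize-∖ (unif e∈E) z∈e) ≤-refl))
        where
        cover : ∀ {x} → x ∈ d ∪ e → Dec (p ≡ x) → Dec (z ≡ x) →
                x ∈ ((d ∖ ｛ p ｝) ∪ ｛ z ｝) ∪ (e ∖ ｛ z ｝)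
        cover (inj₁ x∈d) (no p≢x)   _        = inj₁ (inj₁ (x∈d , p≢x))
        -- `p` stays in `e ∖ ｛ z ｝`, being different from `z`, which is not in `d`.
        cover (inj₁ x∈d) (yes refl) _        = inj₂ (p∈e , λ { refl → z∉d p∈d })
        cover (inj₂ x∈e) _          (no z≢x) = inj₂ (x∈e , z≢x)
        cover (inj₂ x∈e) _          (yes eq) = inj₁ (inj₂ eq)

  -- Cross-intersecting families: edges of size 1, 2 and at least 3.

  module _ (H : CrossIntersectingFamily ℓ a) where
    open CrossIntersectingFamily H

    -- Members of `A` meet `e`, members of `B` meet `d`.
    transversal : ∀ {d e} → d ∈ A → e ∈ B → Transversal hypergraph (d ∪ e)
    transversal d∈A e∈B (inj₁ f∈A) with cross f∈A e∈B
    ... | x , x∈f , x∈e = x , x∈f , inj₂ x∈e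
    transversal d∈A e∈B (inj₂ f∈B) with cross d∈A f∈B
    ... | x , x∈d , x∈f = x , x∈f , inj₁ x∈d

    meet-once : Uniform hypergraph (suc n) → ¬ Colorable hypergraph 3 →
      ∀ {d e p q} → d ∈ A → e ∈ B → p ∈ d → p ∈ e → q ∈ d → q ∈ e → p ≡ q
    meet-once unif ¬col d∈A e∈B p∈d p∈e q∈d q∈e = decidable-stable em λ p≢q →
      ¬col (two-common⇒Colorable hypergraph unif (inj₁ d∈A) (inj₂ e∈B)
        (transversal d∈A e∈B) p≢q p∈d p∈e q∈d q∈e)

    -- Singletons that meet are equal, so all members of `A` equal one fixed member of `B`.
    AtLeast3⇒¬Uniform1 : AtLeast 3 A → ¬ Uniform hypergraph 1
    AtLeast3⇒¬Uniform1 (f , f-inj , f∈A) unif with B-nonempty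
    ... | e , e∈B = contradiction (f-inj (≐-trans (≐e zero) (≐-sym (≐e (suc zero))))) λ ()
      where
      ≐e : ∀ i → f i ≐ e
      ≐e i with cross (f∈A i) e∈B
      ... | x , x∈fᵢ , x∈e = ≐-trans
        (≐-sym (⊆∧HasSize⇒≐ HasSize-｛｝ (unif (inj₁ (f∈A i))) λ { refl → x∈fᵢ }))
        (⊆∧HasSize⇒≐ HasSize-｛｝ (unif (inj₂ e∈B)) λ { refl → x∈e })

    Uniform2⇒¬¬Colorable : Uniform hypergraph 2 → AtLeast 3 A → AtLeast 3 B →
                         ¬ ¬ Colorable hypergraph 3
    Uniform2⇒¬¬Colorable unif A≥3 B≥3 ¬col with A-nonempty | B-nonempty
    ... | d , d∈A | e , e∈B with cross d∈A e∈B
    ... | p , p∈d , p∈e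
      with HasSize⇒∃ (HasSize-∖ (unif (inj₁ d∈A)) p∈d)
         | HasSize⇒∃ (HasSize-∖ (unif (inj₂ e∈B)) p∈e)
    ... | x , x∈d , p≢x | z , z∈e , p≢z = ⊥-from
      (exchange hypergraph unif (inj₁ d∈A) (inj₂ e∈B) (transversal d∈A e∈B)
        ¬col p∈d p∈e z∈e z∉d)
      where
      meet : ∀ {d e p q} → d ∈ A → e ∈ B → p ∈ d → p ∈ e → q ∈ d → q ∈ e → p ≡ q
      meet = meet-once unif ¬col

      z∉d : z ∉ d
      z∉d z∈d = p≢z (meet d∈A e∈B p∈d p∈e z∈d z∈e)

      x≢z : x ≢ z
      x≢z refl = z∉d x∈d

      -- The exchanged edge {x,z} completes the triangle with `d` = {p,x} and `e` = {p,z}. If it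
      -- lies in `B`, the roles of `A` and `B` and of `x` and `z` are swapped.
      ⊥-from : (d ∖ ｛ p ｝) ∪ ｛ z ｝ ∈ A ∪ B → ⊥
      ⊥-from (inj₁ c∈A) = triangle⇒⊥ (unif ∘ inj₁) (unif ∘ inj₂) cross meet A≥3 B≥3
        d∈A c∈A e∈B p≢x x≢z p≢z p∈d x∈d (inj₁ (x∈d , p≢x)) (inj₂ refl) p∈e z∈e
      ⊥-from (inj₂ c∈B) = triangle⇒⊥ (unif ∘ inj₂) (unif ∘ inj₁)
        (λ e∈B f∈A → ≬-sym (cross f∈A e∈B))
        (λ e∈B f∈A p∈e p∈f q∈e q∈f → meet f∈A e∈B p∈f p∈e q∈f q∈e) B≥3 A≥3
        e∈B c∈B d∈A p≢z (x≢z ∘ sym) p≢x p∈e z∈e (inj₂ refl) (inj₁ (x∈d , p≢x)) p∈d x∈d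

    Uniform≥3⇒¬¬Colorable : Uniform hypergraph (suc (suc (suc n))) →
                          ¬ ¬ Colorable hypergraph 3
    Uniform≥3⇒¬¬Colorable unif ¬col with A-nonempty | B-nonempty
    ... | d , d∈A | e , e∈B with cross d∈A e∈B
    ... | p , p∈d , p∈e
      with HasSize-∖ (unif (inj₁ d∈A)) p∈d | HasSize-∖ (unif (inj₂ e∈B)) p∈e
    ... | |d∖p| | |e∖p| with HasSize⇒∃ |d∖p| | HasSize⇒∃ |e∖p|
    ... | x , x∈d∖p@(x∈d , p≢x) | z , z∈e∖p@(z∈e , p≢z)
      -- Here n ≥ 3 enters: `d` has a third vertex `y`, and `e` a third vertex `w`.
      with HasSize⇒∃ (HasSize-∖ |d∖p| x∈d∖p) | HasSize⇒∃ (HasSize-∖ |e∖p| z∈e∖p)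
    ... | y , (y∈d , p≢y) , x≢y | w , (w∈e , p≢w) , z≢w = ⊥-from
      (exchange hypergraph unif (inj₁ d∈A) (inj₂ e∈B) (transversal d∈A e∈B)
        ¬col p∈d p∈e z∈e z∉d)
      (exchange hypergraph unif (inj₂ e∈B) (inj₁ d∈A)
        (λ f∈E → ≬-∪-comm (transversal d∈A e∈B f∈E))
        ¬col p∈e p∈d x∈d x∉e)
      where
      meet : ∀ {d e p q} → d ∈ A → e ∈ B → p ∈ d → p ∈ e → q ∈ d → q ∈ e → p ≡ q
      meet = meet-once unif ¬col

      z∉d : z ∉ d
      z∉d z∈d = p≢z (meet d∈A e∈B p∈d p∈e z∈d z∈e)

      x∉e : x ∉ e
      x∉e x∈e = p≢x (meet d∈A e∈B p∈d p∈e x∈d x∈e)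

      -- The first new edge shares `x` and `y` with `d`, so it is not in `B`; the second shares `z`
      -- and `w` with `e`, so it is not in `A`. But then they lie on opposite sides and share both
      -- `x` and `z`.
      ⊥-from : (d ∖ ｛ p ｝) ∪ ｛ z ｝ ∈ A ∪ B → (e ∖ ｛ p ｝) ∪ ｛ x ｝ ∈ A ∪ B → ⊥
      ⊥-from (inj₂ c∈B) _ = x≢y
        (meet d∈A c∈B x∈d (inj₁ (x∈d , p≢x)) y∈d (inj₁ (y∈d , p≢y)))
      ⊥-from (inj₁ _) (inj₁ c∈A) = z≢w
        (meet c∈A e∈B (inj₁ (z∈e , p≢z)) z∈e (inj₁ (w∈e , p≢w)) w∈e)
      ⊥-from (inj₁ c∈A) (inj₂ c′∈B) = x∉e (subst (_∈ e)
        (sym (meet c∈A c′∈B (inj₁ (x∈d , p≢x)) (inj₂ refl) (inj₂ refl) (inj₁ (z∈e , p≢z))))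
        z∈e)

corollary1p7 : (∀ {p} → ExcludedMiddle p) →
    ∀ {ℓ a} (n : ℕ) .{{_ : NonZero n}} (H : CrossIntersectingFamily ℓ a) →
    let open CrossIntersectingFamily H in
    Uniform hypergraph n →
    AtLeast 3 A → AtLeast 3 B →
    χ≤ hypergraph 3
corollary1p7 em n H unif A≥3 B≥3 =
  Colorable⇒χ≤ hypergraph 3 (decidable-stable em (¬¬colorable n unif))
  where
  open Classical em
  open CrossIntersectingFamily H

  ¬¬colorable : ∀ n .{{_ : NonZero n}} → Uniform hypergraph n → ¬ ¬ Colorable hypergraph 3
  -- For n = 1 the assumptions on the family already contradict each other.
  ¬¬colorable 1 unif _ = AtLeast3⇒¬Uniform1 H A≥3 unif
  ¬¬colorable 2 unif = Uniform2⇒¬¬Colorable H unif A≥3 B≥3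
  ¬¬colorable (suc (suc (suc _))) unif = Uniform≥3⇒¬¬Colorable H unif
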